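{- Let $\theta_1=\phi_1(D)$ and $\theta_2=\phi_2(D)$ be delta operators with poweroids $x^{\{n\}_1}$ and $x^{\{n\}_2}$, and let the connection constants $(m;2\mid n;1)$ be defined by $$x^{\{n\}_1}=\sum_m (m;2\mid n;1)\;x^{\{m\}_2}.$$ Then the polynomials $\sum_m (m;2\mid n;1)\,x^m$, $n=0,1,2,\dots$, are the poweroids $x^{\{n\}_3}$ of the delta operator $\theta_3=\phi_3(D)$ with $\phi_3=\phi_1\circ\phi_2^{ -1}$ (so that $\phi_1=\phi_3\circ\phi_2$). In other words, $(m;2\mid n;1)$ is the coefficient of $x^m$ in the poweroid $x^{\{n\}_3}$.
   Context: Work with polynomials in $x$ (real or complex coefficients); $D=d/dx$. A delta operator is $\theta=\phi(D)$, where $\phi(t)=\sum_{\nu\ge1}k_\nu t^\nu$ is a formal power series with $k_1=1$; $\phi^{ -1}$ is its compositional inverse. The poweroids $x^{\{n\}}$ of $\theta$ are the unique polynomials with $x^{\{0\}}=1$, $\theta x^{\{n\}}=n\,x^{\{n-1\}}$ for $n\ge1$, and $x^{\{n\}}|_{x=0}=0$ for $n\ge1$; $x^{\{n\}}$ has degree $n$. The subscripts $1,2,3$ on $\{n\}$ indicate the delta operator. -}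

module Defs where

open import Algebra.Apartness.Bundles using (HeytingField; HeytingCommutativeRing)
open import Algebra.Bundles using (CommutativeRing; RawMonoid)
import Algebra.Definitions.RawMonoid as RawMonoidDefinitions
import Algebra.Properties.Monoid.Mult as Mult
import Algebra.Properties.Semiring.Exp as Exp
import Algebra.Properties.Semiring.Sum as Sum
open import Data.Fin.Base using (toℕ)
open import Data.Nat.Base using (ℕ; zero; suc; _≤_; _∸_; _⊔_; s≤s)
open import Data.Nat.GeneralisedArithmetic using (fold)
import Data.Nat.Properties as ℕₚ
open import Function.Base using (_∘_)
open import Level using () renaming (_⊔_ to _⊔ˡ_)

-- The coefficient field is an arbitrary field of characteristic zero, in the
-- constructive sense of the library (nonzero means apart from zero); the real
-- and the complex numbers are instances.

module Poweroids {a ℓ₁ ℓ₂} (F : HeytingField a ℓ₁ ℓ₂) where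

  open HeytingField F using (Carrier; _≈_; _#_; _+_; _*_; 0#; 1#; heytingCommutativeRing)
  open CommutativeRing (HeytingCommutativeRing.commutativeRing heytingCommutativeRing)
    using (refl; trans; +-cong; +-identityˡ; *-congˡ; zeroʳ; semiring; +-monoid)
  open Mult +-monoid using (_×_; ×-congʳ)
  open Exp semiring using (_^_)
  open Sum semiring using (sum-syntax)

  CharacteristicZero : Set ℓ₂
  CharacteristicZero = ∀ n → (suc n × 1#) # 0#

  δ : ℕ → ℕ → Carrier
  δ zero    zero    = 1#
  δ zero    (suc _) = 0#
  δ (suc _) zero    = 0#
  δ (suc m) (suc n) = δ m n

  Series : Set a
  Series = ℕ → Carrier

  infix  4 _≈ˢ_
  infixl 7 _*ˢ_
  infixr 8 _^ˢ_
  infixr 9 _∘ˢ_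

  _≈ˢ_ : Series → Series → Set ℓ₁
  f ≈ˢ g = ∀ n → f n ≈ g n

  _*ˢ_ : Series → Series → Series
  (f *ˢ g) n = ∑[ i < suc n ] (f (toℕ i) * g (n ∸ toℕ i))

  _^ˢ_ : Series → ℕ → Series
  g ^ˢ j = fold (δ 0) (g *ˢ_) j

  -- Meaningful when g has zero constant term: then gʲ has order at least j,
  -- so only the powers with j ≤ n contribute to the coefficient of tⁿ in
  -- Σⱼ fⱼ gʲ.
  _∘ˢ_ : Series → Series → Series
  (f ∘ˢ g) n = ∑[ j < suc n ] (f (toℕ j) * (g ^ˢ toℕ j) n)

  t : Series
  t = δ 1

  record IsCompositionalInverse (φ ψ : Series) : Set ℓ₁ where
    field
      zeroConstant : ψ 0 ≈ 0#
      inverseˡ     : (ψ ∘ˢ φ) ≈ˢ t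
      inverseʳ     : (φ ∘ˢ ψ) ≈ˢ t

  record IsDelta (φ : Series) : Set ℓ₁ where
    field
      coeff₀ : φ 0 ≈ 0#
      coeff₁ : φ 1 ≈ 1#

  -- Equality of polynomials is _≋_: the bound is any upper bound for the
  -- support and is not part of the identity of a polynomial.
  record Poly : Set (a ⊔ˡ ℓ₁) where
    field
      coeff    : ℕ → Carrier
      bound    : ℕ
      vanishes : ∀ {i} → bound ≤ i → coeff i ≈ 0#

  open Poly public

  infix  4 _≋_
  infixl 6 _+ₚ_
  infixr 7 _·ₚ_

  _≋_ : Poly → Poly → Set ℓ₁
  p ≋ q = ∀ i → coeff p i ≈ coeff q i

  0ₚ : Poly
  0ₚ = record { coeff = λ _ → 0# ; bound = 0 ; vanishes = λ _ → refl }

  _+ₚ_ : Poly → Poly → Poly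
  p +ₚ q = record
    { coeff    = λ i → coeff p i + coeff q i
    ; bound    = bound p ⊔ bound q
    ; vanishes = λ b≤i → trans
        (+-cong (vanishes p (ℕₚ.m⊔n≤o⇒m≤o (bound p) (bound q) b≤i))
                (vanishes q (ℕₚ.m⊔n≤o⇒n≤o (bound p) (bound q) b≤i)))
        (+-identityˡ 0#)
    }

  _·ₚ_ : Carrier → Poly → Poly
  c ·ₚ p = record
    { coeff    = λ i → c * coeff p i
    ; bound    = bound p
    ; vanishes = λ b≤i → trans (*-congˡ (vanishes p b≤i)) (zeroʳ c)
    }

  ∑ₚ : ℕ → (ℕ → Poly) → Poly
  ∑ₚ n p = RawMonoidDefinitions.sum +ₚ-rawMonoid {n} (p ∘ toℕ)
    where
    +ₚ-rawMonoid : RawMonoid _ _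
    +ₚ-rawMonoid = record { Carrier = Poly ; _≈_ = _≋_ ; _∙_ = _+ₚ_ ; ε = 0ₚ }

  X^_ : ℕ → Poly
  X^ m = record { coeff = δ m ; bound = suc m ; vanishes = δ-vanishes }
    where
    δ-vanishes : ∀ {m i} → suc m ≤ i → δ m i ≈ 0#
    δ-vanishes {zero}  (s≤s _)   = refl
    δ-vanishes {suc m} (s≤s m<i) = δ-vanishes {m} m<i

  eval : Poly → Carrier → Carrier
  eval p x = ∑[ i < bound p ] (coeff p (toℕ i) * x ^ toℕ i)

  D : Poly → Poly
  D p = record
    { coeff    = λ i → suc i × coeff p (suc i)
    ; bound    = bound p
    ; vanishes = λ {i} b≤i → trans
        (×-congʳ (suc i) (vanishes p (ℕₚ.m≤n⇒m≤1+n b≤i))) (×-zero (suc i))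
    }
    where
    ×-zero : ∀ n → n × 0# ≈ 0#
    ×-zero zero    = refl
    ×-zero (suc n) = trans (+-identityˡ (n × 0#)) (×-zero n)

  -- The operator φ(D) = Σ_ν φ_ν D^ν; the terms with ν ≥ bound p vanish on p.
  _⟨D⟩ : Series → Poly → Poly
  (φ ⟨D⟩) p = ∑ₚ (bound p) (λ ν → φ ν ·ₚ fold p D ν)

  record ArePoweroids (φ : Series) (p : ℕ → Poly) : Set ℓ₁ where
    field
      initial : p 0 ≋ X^ 0
      lower   : ∀ n → (φ ⟨D⟩) (p (suc n)) ≋ (suc n × 1#) ·ₚ p n
      atZero  : ∀ n → eval (p (suc n)) 0# ≈ 0#

  -- c m n is the constant written (m;2|n;1): the coefficient of p₂ m in the
  -- expansion of p₁ n.  For each n only finitely many are nonzero.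
  record AreConnectionConstants
           (p₁ p₂ : ℕ → Poly) (c : ℕ → ℕ → Carrier) : Set ℓ₁ where
    field
      range     : ℕ → ℕ
      finite    : ∀ {m n} → range n ≤ m → c m n ≈ 0#
      expansion : ∀ n → p₁ n ≋ ∑ₚ (range n) (λ m → c m n ·ₚ p₂ m)

    connectionPoly : ℕ → Poly
    connectionPoly n = ∑ₚ (range n) (λ m → c m n ·ₚ (X^ m))

{-# OPTIONS --safe #-}

-- Let T be the linear map with T xᵐ = x^{m}₂.  It intertwines D with φ₂(D),
-- hence φ₃(D) with φ₃(φ₂(D)) = (φ₃ ∘ φ₂)(D) = φ₁(D).  T maps the n-th
-- connection polynomial to x^{n}₁ and is injective, so the lowering relation for
-- φ₁ pulls back to the one for φ₃.  The identity (φ₁ ∘ φ₂⁻¹) ∘ φ₂ = φ₁ is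
-- obtained by letting series act on sequences through the shift operator.

module Submission where

open import Defs
open import Algebra.Apartness.Bundles using (HeytingField; HeytingCommutativeRing)
import Algebra.Apartness.Properties.HeytingCommutativeRing as HeytingProperties
open import Algebra.Bundles using (CommutativeRing)
import Algebra.Properties.CommutativeSemigroup as CommutativeSemigroupProperties
import Algebra.Properties.Group as GroupProperties
import Algebra.Properties.Semiring.Exp as Exp
import Algebra.Properties.Semiring.Mult as Mult
import Algebra.Properties.Semiring.Sum as Sum
open import Data.Fin.Base using (toℕ)
open import Data.Nat.Base as ℕ using (ℕ; zero; suc; _∸_; _≤_; _<_; z≤n; s≤s)
open import Data.Nat.GeneralisedArithmetic using (fold; fold-+)
import Data.Nat.Properties as ℕₚ
open import Data.Product.Base using (_×_; _,_)
open import Function.Base using (_∘_)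
open import Level using (_⊔_)
open import Relation.Binary.PropositionalEquality.Core as ≡ using (_≡_)
import Relation.Binary.Reasoning.Setoid as SetoidReasoning
open import Relation.Nullary.Negation using (contradiction)

module _ {a ℓ₁ ℓ₂} (F : HeytingField a ℓ₁ ℓ₂) where

  open HeytingField F
    using (Carrier; _≈_; _+_; _*_; 0#; 1#; heytingCommutativeRing; #⇒invertible)
  open CommutativeRing (HeytingCommutativeRing.commutativeRing heytingCommutativeRing)
    using ( refl; sym; trans; reflexive; setoid; semiring; +-group; +-commutativeSemigroup
          ; +-cong; +-congˡ; +-congʳ; +-assoc; +-identityˡ; +-identityʳ
          ; *-cong; *-congˡ; *-congʳ; *-assoc; *-comm; *-identityˡ; *-identityʳ
          ; zeroˡ; zeroʳ; distribˡ; distribʳ )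
  open HeytingProperties heytingCommutativeRing using (x-0≈x)
  open GroupProperties +-group using () renaming (∙-cancelʳ to +-cancelʳ)
  open Exp semiring using (_^_)
  open Mult semiring using (×-congʳ; ×-assoc-*; ×-comm-*) renaming (_×_ to _×ₙ_)
  open Sum semiring using (sum-syntax)
  open CommutativeSemigroupProperties +-commutativeSemigroup
    using () renaming (interchange to +-interchange)
  open Poweroids F
  open SetoidReasoning setoid

  -- Finite sums

  -- Opaque, so that unification can read the summand off a sum.
  opaque
    ∑< : ℕ → (ℕ → Carrier) → Carrier
    ∑< zero    f = 0#
    ∑< (suc n) f = f 0 + ∑< n (f ∘ suc)

  opaque
    unfolding ∑<

    ∑<-suc : ∀ n f → ∑< (suc n) f ≈ f 0 + ∑< n (f ∘ suc)
    ∑<-suc n f = refl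

    ∑-toℕ : ∀ n f → ∑[ i < n ] f (toℕ i) ≈ ∑< n f
    ∑-toℕ zero    f = refl
    ∑-toℕ (suc n) f = +-congˡ (∑-toℕ n (f ∘ suc))

    ∑<-cong : ∀ n {f g} → (∀ i → i < n → f i ≈ g i) → ∑< n f ≈ ∑< n g
    ∑<-cong zero    eq = refl
    ∑<-cong (suc n) eq = +-cong (eq 0 (s≤s z≤n)) (∑<-cong n λ i i<n → eq (suc i) (s≤s i<n))

    ∑<-zero : ∀ n {f} → (∀ i → i < n → f i ≈ 0#) → ∑< n f ≈ 0#
    ∑<-zero zero    eq = refl
    ∑<-zero (suc n) eq = trans
      (+-cong (eq 0 (s≤s z≤n)) (∑<-zero n λ i i<n → eq (suc i) (s≤s i<n))) (+-identityˡ 0#)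

    ∑<-extend : ∀ {m n} {f} → m ≤ n → (∀ {i} → m ≤ i → f i ≈ 0#) → ∑< m f ≈ ∑< n f
    ∑<-extend {n = n} z≤n       eq = sym (∑<-zero n λ _ _ → eq z≤n)
    ∑<-extend         (s≤s m≤n) eq = +-congˡ (∑<-extend m≤n λ m≤i → eq (s≤s m≤i))

    ∑<-*ˡ : ∀ n x f → x * ∑< n f ≈ ∑< n (λ i → x * f i)
    ∑<-*ˡ zero    x f = zeroʳ x
    ∑<-*ˡ (suc n) x f = trans (distribˡ x _ _) (+-congˡ (∑<-*ˡ n x (f ∘ suc)))

    ∑<-*ʳ : ∀ n x f → ∑< n f * x ≈ ∑< n (λ i → f i * x)
    ∑<-*ʳ zero    x f = zeroˡ x
    ∑<-*ʳ (suc n) x f = trans (distribʳ x _ _) (+-congˡ (∑<-*ʳ n x (f ∘ suc)))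

    ∑<-+ : ∀ n f g → ∑< n (λ i → f i + g i) ≈ ∑< n f + ∑< n g
    ∑<-+ zero    f g = sym (+-identityˡ 0#)
    ∑<-+ (suc n) f g = trans
      (+-congˡ (∑<-+ n (f ∘ suc) (g ∘ suc))) (+-interchange _ _ _ _)

    ∑<-comm : ∀ m n (f : ℕ → ℕ → Carrier) →
              ∑< m (λ i → ∑< n (f i)) ≈ ∑< n (λ j → ∑< m (λ i → f i j))
    ∑<-comm zero    n f = sym (∑<-zero n λ _ _ → refl)
    ∑<-comm (suc m) n f = trans
      (+-congˡ (∑<-comm m n (f ∘ suc))) (sym (∑<-+ n (f 0) _))

    -- The hypothesis handles an index `m` outside the range: no term survives, and `f m` is zero as
    -- well.
    ∑<-δˡ : ∀ n m (f : ℕ → Carrier) → (n ≤ m → f m ≈ 0#) → ∑< n (λ k → δ m k * f k) ≈ f m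
    ∑<-δˡ zero    m       f eq = sym (eq z≤n)
    ∑<-δˡ (suc n) zero    f eq = trans
      (+-cong (*-identityˡ (f 0)) (∑<-zero n λ k _ → zeroˡ (f (suc k)))) (+-identityʳ (f 0))
    ∑<-δˡ (suc n) (suc m) f eq = trans
      (+-cong (zeroˡ (f 0)) (∑<-δˡ n m (f ∘ suc) λ n≤m → eq (s≤s n≤m))) (+-identityˡ (f (suc m)))

    -- Both sides run over the pairs with `i + j < n`, by diagonals on the left and by rows on the
    -- right. The induction splits off the row `i = 0`.
    ∑<-triangle : ∀ n (f : ℕ → ℕ → Carrier) →
                  ∑< n (λ k → ∑< (suc k) (λ i → f i (k ∸ i))) ≈ ∑< n (λ i → ∑< (n ∸ i) (f i))
    ∑<-triangle zero    f = refl
    ∑<-triangle (suc n) f = begin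
      (f 0 0 + 0#) + ∑< n (λ k → f 0 (suc k) + ∑< (suc k) (λ i → f (suc i) (k ∸ i)))
        ≈⟨ +-cong (+-identityʳ _) (∑<-+ n _ _) ⟩
      f 0 0 + (∑< n (f 0 ∘ suc) + ∑< n (λ k → ∑< (suc k) (λ i → f (suc i) (k ∸ i))))
        ≈⟨ +-congˡ (+-congˡ (∑<-triangle n (f ∘ suc))) ⟩
      f 0 0 + (∑< n (f 0 ∘ suc) + ∑< n (λ i → ∑< (n ∸ i) (f (suc i))))
        ≈⟨ +-assoc _ _ _ ⟨
      ∑< (suc n) (f 0) + ∑< n (λ i → ∑< (n ∸ i) (f (suc i)))
        ∎

  δ-sym : ∀ m n → δ m n ≡ δ n m
  δ-sym zero    zero    = ≡.refl
  δ-sym zero    (suc n) = ≡.refl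
  δ-sym (suc m) zero    = ≡.refl
  δ-sym (suc m) (suc n) = δ-sym m n

  ∑<-assoc : ∀ m n (a : ℕ → Carrier) (b : ℕ → ℕ → Carrier) (x : ℕ → Carrier) →
             ∑< m (λ i → a i * ∑< n (λ j → b i j * x j)) ≈
             ∑< n (λ j → ∑< m (λ i → a i * b i j) * x j)
  ∑<-assoc m n a b x = begin
    ∑< m (λ i → a i * ∑< n (λ j → b i j * x j))
      ≈⟨ ∑<-cong m (λ i _ → ∑<-*ˡ n (a i) _) ⟩
    ∑< m (λ i → ∑< n (λ j → a i * (b i j * x j)))
      ≈⟨ ∑<-comm m n _ ⟩
    ∑< n (λ j → ∑< m (λ i → a i * (b i j * x j)))
      ≈⟨ ∑<-cong n (λ j _ → ∑<-cong m λ i _ → *-assoc (a i) (b i j) (x j)) ⟨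
    ∑< n (λ j → ∑< m (λ i → a i * b i j * x j))
      ≈⟨ ∑<-cong n (λ j _ → ∑<-*ʳ m (x j) _) ⟨
    ∑< n (λ j → ∑< m (λ i → a i * b i j) * x j)
      ∎

  ∑<-exchange : ∀ m n (a b : ℕ → Carrier) (x : ℕ → ℕ → Carrier) →
                ∑< m (λ i → a i * ∑< n (λ j → b j * x i j)) ≈
                ∑< n (λ j → b j * ∑< m (λ i → a i * x i j))
  ∑<-exchange m n a b x = begin
    ∑< m (λ i → a i * ∑< n (λ j → b j * x i j))
      ≈⟨ ∑<-cong m (λ i _ → ∑<-*ˡ n (a i) _) ⟩
    ∑< m (λ i → ∑< n (λ j → a i * (b j * x i j)))
      ≈⟨ ∑<-comm m n _ ⟩
    ∑< n (λ j → ∑< m (λ i → a i * (b j * x i j)))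
      ≈⟨ ∑<-cong n (λ j _ → ∑<-cong m λ i _ → x*yz≈y*xz (a i) (b j) (x i j)) ⟩
    ∑< n (λ j → ∑< m (λ i → b j * (a i * x i j)))
      ≈⟨ ∑<-cong n (λ j _ → ∑<-*ˡ m (b j) _) ⟨
    ∑< n (λ j → b j * ∑< m (λ i → a i * x i j))
      ∎
    where
    x*yz≈y*xz : ∀ x y z → x * (y * z) ≈ y * (x * z)
    x*yz≈y*xz x y z =
      trans (sym (*-assoc x y z)) (trans (*-congʳ (*-comm x y)) (*-assoc y x z))

  ∑<-δʳ : ∀ n m (f : ℕ → Carrier) → (n ≤ m → f m ≈ 0#) → ∑< n (λ k → f k * δ k m) ≈ f m
  ∑<-δʳ n m f eq = trans
    (∑<-cong n λ k _ → trans (*-comm (f k) (δ k m)) (*-congʳ (reflexive (δ-sym k m))))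
    (∑<-δˡ n m f eq)

  -- Linear operators on sequences

  Operator : Set a
  Operator = Series → Series

  0ˢ : Series
  0ˢ _ = 0#

  combination : ℕ → Series → (ℕ → Series) → Series
  combination n c u i = ∑< n (λ k → c k * u k i)

  -- Finite combinations serve as the primitive notion because series in an operator are such
  -- combinations; the empty one yields `0ˢ-homo`.
  record IsLinear (A : Operator) : Set (a ⊔ ℓ₁) where
    field
      cong             : ∀ {u v} → u ≈ˢ v → A u ≈ˢ A v
      combination-homo : ∀ n c u → A (combination n c u) ≈ˢ combination n c (A ∘ u)

    0ˢ-homo : A 0ˢ ≈ˢ 0ˢ
    0ˢ-homo i = trans (cong (λ _ → sym (∑<-zero 0 λ _ ())) i)
      (trans (combination-homo 0 0ˢ (λ _ → 0ˢ) i) (∑<-zero 0 λ _ ()))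

  open IsLinear

  combination-cong : ∀ n {c d} {u v : ℕ → Series} → (∀ k → k < n → c k ≈ d k) →
                     (∀ k → k < n → u k ≈ˢ v k) → combination n c u ≈ˢ combination n d v
  combination-cong n c≈d u≈v i = ∑<-cong n λ k k<n → *-cong (c≈d k k<n) (u≈v k k<n i)

  fold-linear : ∀ {A} → IsLinear A → ∀ k → IsLinear (λ v → fold v A k)
  fold-linear lin zero = record
    { cong             = λ u≈v → u≈v
    ; combination-homo = λ _ _ _ _ → refl
    }
  fold-linear lin (suc k) = record
    { cong             = λ u≈v → cong lin (cong IH u≈v)
    ; combination-homo = λ n c u i → trans
        (cong lin (combination-homo IH n c u) i) (combination-homo lin n c _ i)
    }
    where IH = fold-linear lin k

  -- Nilpotency at a single sequence: `∂` and `shift` are not nilpotent globally, but a high power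
  -- kills each finitely supported sequence.
  Nilpotent : ℕ → Operator → Series → Set ℓ₁
  Nilpotent N A v = ∀ {k} → N ≤ k → fold v A k ≈ˢ 0ˢ

  Nilpotent-step : ∀ {N A v} → Nilpotent N A v → Nilpotent N A (A v)
  Nilpotent-step {N} {A} {v} nil {k} N≤k i = begin
    fold (A v) A k i     ≡⟨ ≡.cong (λ w → w i) (fold-+ v A k) ⟨
    fold v A (k ℕ.+ 1) i ≈⟨ nil (ℕₚ.m≤n⇒m≤n+o 1 N≤k) i ⟩
    0#                   ∎

  -- f(A) v, truncated before Aᴺ; independent of N as soon as Aᴺ v = 0.
  apply : ℕ → Series → Operator → Operator
  apply N f A v = combination N f (fold v A)

  apply-linear : ∀ N f {A} → IsLinear A → IsLinear (apply N f A)
  apply-linear N f lin = record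
    { cong             = λ u≈v → combination-cong N (λ _ _ → refl)
                           (λ k _ → cong (fold-linear lin k) u≈v)
    ; combination-homo = λ n c u i → trans
        (∑<-cong N λ k _ → *-congˡ (combination-homo (fold-linear lin k) n c u i))
        (∑<-exchange N n f c _)
    }

  -- Both truncations can be lengthened to the larger of `M` and `N`, since all added terms vanish.
  apply-irrelevant : ∀ {M N} f {A v} → Nilpotent M A v → Nilpotent N A v →
                     apply M f A v ≈ˢ apply N f A v
  apply-irrelevant {M} {N} f nilM nilN i = trans
    (∑<-extend (ℕₚ.m≤m⊔n M N) λ M≤k → trans (*-congˡ (nilM M≤k i)) (zeroʳ _))
    (sym (∑<-extend (ℕₚ.m≤n⊔m M N) λ N≤k → trans (*-congˡ (nilN N≤k i)) (zeroʳ _)))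

  apply-cong : ∀ N {f g} A v → f ≈ˢ g → apply N f A v ≈ˢ apply N g A v
  apply-cong N A v f≈g = combination-cong N (λ k _ → f≈g k) (λ _ _ _ → refl)

  *ˢ-∑< : ∀ f g n → (f *ˢ g) n ≈ ∑< (suc n) (λ i → f i * g (n ∸ i))
  *ˢ-∑< f g n = ∑-toℕ (suc n) (λ i → f i * g (n ∸ i))

  -- The Cauchy product gives the pairs with `k + j < N`, the composite of operators the full
  -- square. The remaining pairs carry a power of `A` that kills `v`.
  apply-* : ∀ {N} f g {A v} → IsLinear A → Nilpotent N A v →
            apply N (f *ˢ g) A v ≈ˢ apply N f A (apply N g A v)
  apply-* {N} f g {A} {v} lin nil i = begin
    ∑< N (λ n → (f *ˢ g) n * x n)
      ≈⟨ ∑<-cong N (λ n _ → trans (*-congʳ (*ˢ-∑< f g n)) (∑<-*ʳ (suc n) (x n) _)) ⟩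
    ∑< N (λ n → ∑< (suc n) (λ k → (f k * g (n ∸ k)) * x n))
      ≈⟨ ∑<-cong N (λ n _ → ∑<-cong (suc n) λ { k (s≤s k≤n) →
           *-congˡ (reflexive (≡.cong x (≡.sym (ℕₚ.m+[n∸m]≡n k≤n)))) }) ⟩
    ∑< N (λ n → ∑< (suc n) (λ k → y k (n ∸ k)))
      ≈⟨ ∑<-triangle N y ⟩
    ∑< N (λ k → ∑< (N ∸ k) (y k))
      ≈⟨ ∑<-cong N (λ k _ → ∑<-extend (ℕₚ.m∸n≤m N k) λ N∸k≤j →
           trans (*-congˡ (nil (N≤k+j k N∸k≤j) i)) (zeroʳ _)) ⟩
    ∑< N (λ k → ∑< N (y k))
      ≈⟨ ∑<-cong N (λ k _ → ∑<-cong N λ j _ → trans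
           (*-assoc (f k) (g j) _)
           (*-congˡ (*-congˡ (reflexive (≡.cong (λ w → w i) (fold-+ v A k)))))) ⟩
    ∑< N (λ k → ∑< N (λ j → f k * (g j * fold (fold v A j) A k i)))
      ≈⟨ ∑<-cong N (λ k _ → ∑<-*ˡ N (f k) _) ⟨
    ∑< N (λ k → f k * ∑< N (λ j → g j * fold (fold v A j) A k i))
      ≈⟨ ∑<-cong N (λ k _ → *-congˡ
           (combination-homo (fold-linear lin k) N g (fold v A) i)) ⟨
    apply N f A (apply N g A v) i
      ∎
    where
    x : ℕ → Carrier
    x n = fold v A n i
    y : ℕ → ℕ → Carrier
    y k j = (f k * g j) * x (k ℕ.+ j)
    N≤k+j : ∀ k {j} → N ∸ k ≤ j → N ≤ k ℕ.+ j
    N≤k+j k N∸k≤j = ℕₚ.≤-trans (ℕₚ.m≤n+m∸n N k) (ℕₚ.+-monoʳ-≤ k N∸k≤j)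

  apply-^ : ∀ {N} g j {A v} → IsLinear A → Nilpotent N A v →
            apply N (g ^ˢ j) A v ≈ˢ fold v (apply N g A) j
  apply-^ {N} g zero    lin nil i = ∑<-δˡ N 0 _ λ N≤0 → nil N≤0 i
  apply-^ {N} g (suc j) lin nil i = trans
    (apply-* g (g ^ˢ j) lin nil i) (cong (apply-linear N g lin) (apply-^ g j lin nil) i)

  -- In the product of `g` with its previous power, the term `i = 0` contains `g 0`; for every other
  -- term the complementary index is below the previous exponent.
  ^ˢ-order : ∀ g → g 0 ≈ 0# → ∀ {n} j → n < j → (g ^ˢ j) n ≈ 0#
  ^ˢ-order g g₀≈0 {n} (suc j) (s≤s n≤j) = trans (*ˢ-∑< g (g ^ˢ j) n) (∑<-zero (suc n) λ
    { zero    _         → trans (*-congʳ g₀≈0) (zeroˡ _)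
    ; (suc i) (s≤s i<n) → trans
        (*-congˡ (^ˢ-order g g₀≈0 j
          (ℕₚ.<-≤-trans (ℕₚ.∸-monoʳ-< {n} {suc i} {0} (s≤s z≤n) i<n) n≤j)))
        (zeroʳ _)
    })

  -- The `k`-th power of g(A) is the series `g ^ˢ k` in A, whose order is at least `k`, so nothing
  -- remains before the truncation. Hence the same `N` serves for g(A).
  apply-nilpotent : ∀ {N} {g} → g 0 ≈ 0# → ∀ {A v} → IsLinear A → Nilpotent N A v →
                    Nilpotent N (apply N g A) v
  apply-nilpotent {N} {g} g₀≈0 lin nil {k} N≤k i = trans
    (sym (apply-^ g k lin nil i))
    (∑<-zero N λ n n<N → trans
      (*-congʳ (^ˢ-order g g₀≈0 k (ℕₚ.<-≤-trans n<N N≤k))) (zeroˡ _))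

  -- Substitution of series becomes substitution of operators: both sides are one double sum over
  -- powers of `g` and powers of `A`.
  apply-∘ : ∀ {N} f {g} → g 0 ≈ 0# → ∀ {A v} → IsLinear A → Nilpotent N A v →
            apply N (f ∘ˢ g) A v ≈ˢ apply N f (apply N g A) v
  apply-∘ {N} f {g} g₀≈0 {A} {v} lin nil i = begin
    ∑< N (λ n → (f ∘ˢ g) n * fold v A n i)
      ≈⟨ ∑<-cong N (λ n n<N → *-congʳ (trans
           (∑-toℕ (suc n) (λ j → f j * (g ^ˢ j) n))
           -- All inner sums get the common length `N`: the powers with `n < j` have order above `n`
           -- and add nothing.
           (∑<-extend n<N λ {j} n<j →
             trans (*-congˡ (^ˢ-order g g₀≈0 j n<j)) (zeroʳ _)))) ⟩
    ∑< N (λ n → ∑< N (λ j → f j * (g ^ˢ j) n) * fold v A n i)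
      ≈⟨ ∑<-assoc N N f (λ j → g ^ˢ j) _ ⟨
    ∑< N (λ j → f j * apply N (g ^ˢ j) A v i)
      ≈⟨ ∑<-cong N (λ j _ → *-congˡ (apply-^ g j lin nil i)) ⟩
    apply N f (apply N g A) v i
      ∎

  apply-t : ∀ {N A v} → Nilpotent N A v → apply N t A v ≈ˢ A v
  apply-t {N} nil i = ∑<-δˡ N 1 _ λ N≤1 → nil N≤1 i

  -- Cancellation of a compositional inverse

  shift : Operator
  shift v i = v (suc i)

  shift-linear : IsLinear shift
  shift-linear = record
    { cong             = λ u≈v i → u≈v (suc i)
    ; combination-homo = λ _ _ _ _ → refl
    }

  fold-shift : ∀ v k i → fold v shift k i ≡ v (k ℕ.+ i)
  fold-shift v zero    i = ≡.refl
  fold-shift v (suc k) i =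
    ≡.trans (fold-shift v k (suc i)) (≡.cong v (ℕₚ.+-suc k i))

  shift-nilpotent : ∀ n → Nilpotent (suc n) shift (δ n)
  shift-nilpotent n {k} n<k i = trans
    (reflexive (fold-shift (δ n) k i)) (vanishes (X^ n) (ℕₚ.m≤n⇒m≤n+o i n<k))

  -- Shifting `δ n` exactly `n` times brings its 1 to the front, so a series can be recovered from
  -- its action through `shift`.
  apply-shift : ∀ f n → apply (suc n) f shift (δ n) 0 ≈ f n
  apply-shift f n = trans
    (∑<-cong (suc n) λ k _ → *-congˡ (reflexive (≡.trans
      (fold-shift (δ n) k 0)
      (≡.trans (≡.cong (δ n) (ℕₚ.+-identityʳ k)) (δ-sym n k)))))
    (∑<-δʳ (suc n) n f λ n<n → contradiction n<n (ℕₚ.n≮n n))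

  module _ {φ ψ : Series} (φ₀≈0 : φ 0 ≈ 0#) (ψ₀≈0 : ψ 0 ≈ 0#) (ψ∘φ≈t : (ψ ∘ˢ φ) ≈ˢ t) where

    -- ψ(φ(A)) acts as A. The claim covers all iterates because they are what an outer series in
    -- ψ(φ(A)) combines.
    apply-inverse : ∀ {N A v} → IsLinear A → Nilpotent N A v →
                    ∀ k → fold v (apply N ψ (apply N φ A)) k ≈ˢ fold v A k
    apply-inverse {N} {A} {v} lin nil zero    i = refl
    apply-inverse {N} {A} {v} lin nil (suc k) i = begin
      apply N ψ B (fold v (apply N ψ B) k) i
        ≈⟨ cong (apply-linear N ψ (apply-linear N φ lin)) (apply-inverse lin nil k) i ⟩
      apply N ψ B w i          ≈⟨ apply-∘ ψ φ₀≈0 lin nilw i ⟨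
      apply N (ψ ∘ˢ φ) A w i   ≈⟨ apply-cong N A w ψ∘φ≈t i ⟩
      apply N t A w i          ≈⟨ apply-t nilw i ⟩
      A w i                    ∎
      where
      B = apply N φ A
      w = fold v A k
      nil-fold : ∀ k → Nilpotent N A (fold v A k)
      nil-fold zero    = nil
      nil-fold (suc k) = Nilpotent-step (nil-fold k)
      nilw = nil-fold k

    -- With S the shift, both sides act on `δ n` alike: f(ψ(φ(S))) = f(S). Entry 0 then gives the
    -- `n`-th coefficients, so associativity of composition is never proved for series themselves.
    ∘ˢ-cancelʳ : ∀ f → ((f ∘ˢ ψ) ∘ˢ φ) ≈ˢ f
    ∘ˢ-cancelʳ f n = begin
      ((f ∘ˢ ψ) ∘ˢ φ) n                   ≈⟨ apply-shift _ n ⟨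
      apply N ((f ∘ˢ ψ) ∘ˢ φ) shift v 0   ≈⟨ apply-∘ (f ∘ˢ ψ) φ₀≈0 shift-linear nil 0 ⟩
      apply N (f ∘ˢ ψ) B v 0
        ≈⟨ apply-∘ f ψ₀≈0 (apply-linear N φ shift-linear)
             (apply-nilpotent φ₀≈0 shift-linear nil) 0 ⟩
      apply N f (apply N ψ B) v 0
        ≈⟨ combination-cong N {f} (λ _ _ → refl) (λ k _ → apply-inverse shift-linear nil k) 0 ⟩
      apply N f shift v 0                 ≈⟨ apply-shift f n ⟩
      f n                                 ∎
      where
      N = suc n
      v = δ n
      B = apply N φ shift
      nil = shift-nilpotent n

  -- Differentiation of coefficient sequences

  ∂ : Operator
  ∂ v i = suc i ×ₙ v (suc i)

  ×ₙ-1 : ∀ n x → n ×ₙ x ≈ (n ×ₙ 1#) * x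
  ×ₙ-1 n x = sym (trans (×-assoc-* n 1# x) (×-congʳ n (*-identityˡ x)))

  ∂-linear : IsLinear ∂
  ∂-linear = record
    { cong             = λ u≈v i → ×-congʳ (suc i) (u≈v (suc i))
    ; combination-homo = λ n c u i → begin
        suc i ×ₙ combination n c u (suc i)            ≈⟨ ×ₙ-1 (suc i) _ ⟩
        (suc i ×ₙ 1#) * combination n c u (suc i)     ≈⟨ ∑<-*ˡ n _ _ ⟩
        ∑< n (λ k → (suc i ×ₙ 1#) * (c k * u k (suc i)))
          ≈⟨ ∑<-cong n (λ k _ → trans (sym (×ₙ-1 (suc i) _)) (sym (×-comm-* (suc i) (c k) _))) ⟩
        combination n c (∂ ∘ u) i                     ∎
    }

  -- Entry `i` of the `k`-th derivative is a multiple of the single entry `k + i` of the original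
  -- sequence.
  fold-∂-cong : ∀ {u v} k i → u (k ℕ.+ i) ≈ v (k ℕ.+ i) → fold u ∂ k i ≈ fold v ∂ k i
  fold-∂-cong         zero    i eq = eq
  fold-∂-cong {u} {v} (suc k) i eq = ×-congʳ (suc i) (fold-∂-cong k (suc i)
    (≡.subst (λ j → u j ≈ v j) (≡.sym (ℕₚ.+-suc k i)) eq))

  Below : ℕ → Series → Set ℓ₁
  Below N v = ∀ {i} → N ≤ i → v i ≈ 0#

  fold-∂-Below : ∀ {N v} → Below N v → ∀ k i → N ≤ k ℕ.+ i → fold v ∂ k i ≈ 0#
  fold-∂-Below below k i N≤k+i = trans
    (fold-∂-cong {v = 0ˢ} k i (below N≤k+i)) (0ˢ-homo (fold-linear ∂-linear k) i)

  ∂-nilpotent : ∀ {N v} → Below N v → Nilpotent N ∂ v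
  ∂-nilpotent below {k} N≤k i = fold-∂-Below below k i (ℕₚ.m≤n⇒m≤n+o i N≤k)

  apply-∂-Below : ∀ {N v} f → Below N v → Below N (apply N f ∂ v)
  apply-∂-Below {N} f below {i} N≤i = ∑<-zero N λ k _ → trans
    (*-congˡ (fold-∂-Below below k i (ℕₚ.m≤n⇒m≤o+n k N≤i))) (zeroʳ (f k))

  -- Polynomials as sequences

  coeff-∑ₚ : ∀ n p i → coeff (∑ₚ n p) i ≈ ∑< n (λ k → coeff (p k) i)
  coeff-∑ₚ zero    p i = sym (∑<-zero 0 λ _ ())
  coeff-∑ₚ (suc n) p i = trans (+-congˡ (coeff-∑ₚ n (p ∘ suc) i)) (sym (∑<-suc n _))

  coeff-fold-D : ∀ p k → coeff (fold p D k) ≈ˢ fold (coeff p) ∂ k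
  coeff-fold-D p zero    i = refl
  coeff-fold-D p (suc k) i = ×-congʳ (suc i) (coeff-fold-D p k (suc i))

  -- Replaces the truncation at `bound p` by any `N` beyond the support, so that polynomials with
  -- different bounds can share one truncation.
  ⟨D⟩-apply : ∀ {N} φ p → Below N (coeff p) →
              coeff ((φ ⟨D⟩) p) ≈ˢ apply N φ ∂ (coeff p)
  ⟨D⟩-apply {N} φ p below i = begin
    coeff ((φ ⟨D⟩) p) i
      ≈⟨ coeff-∑ₚ (bound p) (λ k → φ k ·ₚ fold p D k) i ⟩
    ∑< (bound p) (λ k → φ k * coeff (fold p D k) i)
      ≈⟨ ∑<-cong (bound p) (λ k _ → *-congˡ (coeff-fold-D p k i)) ⟩
    apply (bound p) φ ∂ (coeff p) i
      ≈⟨ apply-irrelevant φ (∂-nilpotent (vanishes p)) (∂-nilpotent below) i ⟩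
    apply N φ ∂ (coeff p) i
      ∎

  eval-0 : ∀ p → eval p 0# ≈ coeff p 0
  eval-0 p = trans (∑-toℕ (bound p) (λ k → coeff p k * 0# ^ k)) (trans
    (∑<-cong (bound p) λ k _ → *-congˡ (0^k≈δ k))
    (∑<-δʳ (bound p) 0 (coeff p) (vanishes p)))
    where
    0^k≈δ : ∀ k → 0# ^ k ≈ δ k 0
    0^k≈δ zero    = refl
    0^k≈δ (suc k) = zeroˡ _

  -- Characteristic zero and the kernel of a delta operator

  module _ (char0 : CharacteristicZero) where

    ×ₙ-cancelˡ : ∀ n {x y} → suc n ×ₙ x ≈ suc n ×ₙ y → x ≈ y
    ×ₙ-cancelˡ n {x} {y} nx≈ny with #⇒invertible (char0 n)
    ... | n⁻¹ , n⁻¹*n≈1 , _ = begin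
      x                          ≈⟨ step x ⟨
      n⁻¹ * (suc n ×ₙ x)         ≈⟨ *-congˡ nx≈ny ⟩
      n⁻¹ * (suc n ×ₙ y)         ≈⟨ step y ⟩
      y                          ∎
      where
      step : ∀ z → n⁻¹ * (suc n ×ₙ z) ≈ z
      step z = begin
        n⁻¹ * (suc n ×ₙ z)            ≈⟨ *-congˡ (×ₙ-1 (suc n) z) ⟩
        n⁻¹ * ((suc n ×ₙ 1#) * z)     ≈⟨ *-assoc _ _ _ ⟨
        -- Apartness from `0#` supplies an inverse of the difference with `0#`, hence the use of
        -- `x-0≈x`.
        n⁻¹ * (suc n ×ₙ 1#) * z       ≈⟨ *-congʳ (trans (*-congˡ (sym (x-0≈x _))) n⁻¹*n≈1) ⟩
        1# * z                        ≈⟨ *-identityˡ z ⟩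
        z                             ∎

    -- Read from the top degree downwards: once the coefficients above i + 1
    -- agree, the i-th coefficient of φ(D) u determines (i + 1) u_{i+1}.
    apply-∂-injective : ∀ {φ} → IsDelta φ → ∀ {M k u v} → Below (2 ℕ.+ M) u → Below (2 ℕ.+ M) v →
      (∀ {i} → k ≤ i → apply (2 ℕ.+ M) φ ∂ u i ≈ apply (2 ℕ.+ M) φ ∂ v i) →
      ∀ {i} → k < i → u i ≈ v i
    apply-∂-injective {φ} isDelta {M} {k} {u} {v} belowᵤ belowᵥ eq {i} k<i =
      descend (2 ℕ.+ M) k<i (ℕₚ.m≤m+n (2 ℕ.+ M) i)
      where
      open IsDelta isDelta
      tail : Series → ℕ → Carrier
      tail w i = ∑< M (λ ν → φ (2 ℕ.+ ν) * fold w ∂ (2 ℕ.+ ν) i)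
      leading : ∀ w i → apply (2 ℕ.+ M) φ ∂ w i ≈ suc i ×ₙ w (suc i) + tail w i
      leading w i = trans (trans (∑<-suc (suc M) _) (+-congˡ (∑<-suc M _))) (trans
        (+-cong (trans (*-congʳ coeff₀) (zeroˡ _))
                (+-congʳ (trans (*-congʳ coeff₁) (*-identityˡ _))))
        (+-identityˡ _))
      -- `d` bounds the distance from `i` to the end of the support; it decreases as the argument
      -- passes to higher entries.
      descend : ∀ d {i} → k < i → 2 ℕ.+ M ≤ d ℕ.+ i → u i ≈ v i
      descend zero    k<i N≤i = trans (belowᵤ N≤i) (sym (belowᵥ N≤i))
      descend (suc d) {suc i} (s≤s k≤i) N≤d+i = ×ₙ-cancelˡ i (+-cancelʳ (tail u i) _ _ (begin
        suc i ×ₙ u (suc i) + tail u i  ≈⟨ leading u i ⟨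
        apply (2 ℕ.+ M) φ ∂ u i        ≈⟨ eq k≤i ⟩
        apply (2 ℕ.+ M) φ ∂ v i        ≈⟨ leading v i ⟩
        suc i ×ₙ v (suc i) + tail v i  ≈⟨ +-congˡ (∑<-cong M λ ν _ →
                                            *-congˡ (fold-∂-cong (2 ℕ.+ ν) i (higher ν))) ⟨
        suc i ×ₙ v (suc i) + tail u i  ∎))
        where
        higher : ∀ ν → u (2 ℕ.+ ν ℕ.+ i) ≈ v (2 ℕ.+ ν ℕ.+ i)
        higher ν = descend d
          (ℕₚ.m≤n⇒m≤1+n (s≤s (ℕₚ.m≤n⇒m≤o+n ν k≤i)))
          (ℕₚ.≤-trans N≤d+i (ℕₚ.≤-trans (ℕₚ.≤-reflexive (≡.sym (ℕₚ.+-suc d (suc i))))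
            (ℕₚ.+-monoʳ-≤ d (s≤s (s≤s (ℕₚ.m≤n+m i ν))))))

    -- Poweroids of one delta operator

    module PoweroidProperties {φ} (isDelta : IsDelta φ) {p : ℕ → Poly}
                              (isPoweroids : ArePoweroids φ p) where
      open ArePoweroids isPoweroids

      lower-apply : ∀ {N} n → Below N (coeff (p (suc n))) → ∀ i →
                    apply N φ ∂ (coeff (p (suc n))) i ≈ (suc n ×ₙ 1#) * coeff (p n) i
      lower-apply n below i = trans (sym (⟨D⟩-apply φ (p (suc n)) below i)) (lower n i)

      -- By induction φ(D) sends the next poweroid to a multiple of the previous one, which vanishes
      -- in high degree. There it agrees with φ(D) 0, and injectivity above a given degree applies.
      degree : ∀ n → Below (suc n) (coeff (p n))
      degree zero    {i} 0<i = trans (initial i) (vanishes (X^ 0) 0<i)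
      degree (suc n) {i} n<i = apply-∂-injective isDelta below (λ _ → refl) (λ {i} n≤i → begin
        apply N φ ∂ (coeff (p (suc n))) i  ≈⟨ lower-apply n below i ⟩
        (suc n ×ₙ 1#) * coeff (p n) i      ≈⟨ trans (*-congˡ (degree n n≤i)) (zeroʳ _) ⟩
        0#                                 ≈⟨ 0ˢ-homo (apply-linear N φ ∂-linear) i ⟨
        apply N φ ∂ 0ˢ i                   ∎) n<i
        where
        -- The added 2 gives `N` the form that `apply-∂-injective` asks for.
        N = 2 ℕ.+ bound (p (suc n))
        below : Below N (coeff (p (suc n)))
        below N≤i = vanishes (p (suc n)) (ℕₚ.m+n≤o⇒n≤o 2 N≤i)

      coeff-0 : ∀ n → coeff (p n) 0 ≈ δ n 0
      coeff-0 zero    = initial 0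
      coeff-0 (suc n) = trans (sym (eval-0 (p (suc n)))) (atZero n)

      -- The linear map xᵐ ↦ p m, on polynomials of degree at most M.
      module Expansion (M : ℕ) where

        N = suc M

        T : Operator
        T v = combination N v (coeff ∘ p)

        B : Operator
        B = apply N φ ∂

        B-linear : IsLinear B
        B-linear = apply-linear N φ ∂-linear

        T-linear : IsLinear T
        T-linear = record
          { cong             = λ u≈v → combination-cong N (λ k _ → u≈v k) (λ _ _ _ → refl)
          ; combination-homo = λ n c u i → sym (∑<-assoc n N c u (λ m → coeff (p m) i))
          }

        T-Below : ∀ v → Below N (T v)
        T-Below v {i} N≤i = ∑<-zero N λ m m<N → trans
          (*-congˡ (degree m (ℕₚ.≤-trans m<N N≤i))) (zeroʳ (v m))

        T-0 : ∀ v → T v 0 ≈ v 0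
        T-0 v = trans (∑<-cong N λ m _ → *-congˡ (coeff-0 m)) (∑<-δʳ N 0 v λ ())

        T-δ0 : T (δ 0) ≈ˢ coeff (p 0)
        T-δ0 i = ∑<-δˡ N 0 _ λ ()

        -- `p 0` is constant, so truncation at 1 suffices and only the zero constant coefficient of
        -- `φ` is left.
        B-p0 : B (coeff (p 0)) ≈ˢ 0ˢ
        B-p0 i = begin
          apply N φ ∂ (coeff (p 0)) i  ≈⟨ apply-irrelevant φ
                                            (∂-nilpotent (λ N≤i → degree 0 (ℕₚ.≤-trans (s≤s z≤n) N≤i)))
                                            (∂-nilpotent (degree 0)) i ⟩
          apply 1 φ ∂ (coeff (p 0)) i  ≈⟨ trans (∑<-suc 0 _) (+-congˡ (∑<-zero 0 λ _ ())) ⟩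
          φ 0 * coeff (p 0) i + 0#     ≈⟨ +-identityʳ _ ⟩
          φ 0 * coeff (p 0) i          ≈⟨ *-congʳ (IsDelta.coeff₀ isDelta) ⟩
          0# * coeff (p 0) i           ≈⟨ zeroˡ _ ⟩
          0#                           ∎

        -- φ(D) lowers the poweroids just as D lowers the powers of x; the term of `p 0` drops out
        -- and the others move down one index.
        intertwines : ∀ {v} → Below N v → B (T v) ≈ˢ T (∂ v)
        intertwines {v} below i = begin
          B (T v) i
            ≈⟨ trans (combination-homo B-linear N v (coeff ∘ p) i) (∑<-suc M _) ⟩
          v 0 * B (coeff (p 0)) i + ∑< M (λ m → v (suc m) * B (coeff (p (suc m))) i)
            ≈⟨ +-cong (trans (*-congˡ (B-p0 i)) (zeroʳ _)) (∑<-cong M λ m m<M → begin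
                 v (suc m) * B (coeff (p (suc m))) i
                   ≈⟨ *-congˡ (lower-apply m
                        (λ N≤i → degree (suc m) (ℕₚ.≤-trans (s≤s m<M) N≤i)) i) ⟩
                 v (suc m) * ((suc m ×ₙ 1#) * coeff (p m) i)
                   ≈⟨ *-assoc _ _ _ ⟨
                 v (suc m) * (suc m ×ₙ 1#) * coeff (p m) i
                   ≈⟨ *-congʳ (trans (×-comm-* (suc m) _ 1#) (×-congʳ (suc m) (*-identityʳ _))) ⟩
                 ∂ v m * coeff (p m) i
                   ∎) ⟩
          0# + ∑< M (λ m → ∂ v m * coeff (p m) i)
            ≈⟨ +-identityˡ _ ⟩
          ∑< M (λ m → ∂ v m * coeff (p m) i)
            -- The reindexed sum has length `M`; the missing term of index `M` involves `v (suc M)`,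
            -- which is zero.
            ≈⟨ ∑<-extend (ℕₚ.n≤1+n M) (λ {m} M≤m → trans
                 (*-congʳ (fold-∂-Below below 1 m (s≤s M≤m))) (zeroˡ _)) ⟩
          T (∂ v) i
            ∎

        fold-intertwines : ∀ {v} → Below N v → ∀ k → fold (T v) B k ≈ˢ T (fold v ∂ k)
        fold-intertwines below zero    i = refl
        fold-intertwines below (suc k) i = trans
          (cong B-linear (fold-intertwines below k) i)
          (intertwines (λ {j} N≤j → fold-∂-Below below k j (ℕₚ.m≤n⇒m≤o+n k N≤j)) i)

        apply-intertwines : ∀ f {v} → Below N v → apply N f B (T v) ≈ˢ T (apply N f ∂ v)
        apply-intertwines f {v} below i = trans
          (combination-cong N {f} (λ _ _ → refl) (λ k _ → fold-intertwines below k) i)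
          (sym (combination-homo T-linear N f (fold v ∂) i))

        -- Constant terms are visible through `T-0`. For entry `k + 1`, intertwining shows that the
        -- derivatives also have equal images, and their entry `k` is k + 1 times the one sought.
        T-injective : ∀ {u v} → Below N u → Below N v → T u ≈ˢ T v → u ≈ˢ v
        T-injective {u} {v} belowᵤ belowᵥ eq zero    = trans (sym (T-0 u)) (trans (eq 0) (T-0 v))
        T-injective {u} {v} belowᵤ belowᵥ eq (suc k) = ×ₙ-cancelˡ k (T-injective
          (λ {i} N≤i → fold-∂-Below belowᵤ 1 i (ℕₚ.m≤n⇒m≤1+n N≤i))
          (λ {i} N≤i → fold-∂-Below belowᵥ 1 i (ℕₚ.m≤n⇒m≤1+n N≤i))
          (λ i → trans (sym (intertwines belowᵤ i))
                   (trans (cong B-linear eq i) (intertwines belowᵥ i)))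
          k)

    -- Uniqueness of poweroids

    poweroids-unique : ∀ {φ} → IsDelta φ → ∀ {p q} → ArePoweroids φ p → ArePoweroids φ q →
                       ∀ n → p n ≋ q n
    poweroids-unique {φ} isDelta {p} {q} pp qq = unique
      where
      module P = PoweroidProperties isDelta pp
      module Q = PoweroidProperties isDelta qq
      unique : ∀ n → p n ≋ q n
      unique zero    i       = trans (ArePoweroids.initial pp i) (sym (ArePoweroids.initial qq i))
      unique (suc n) zero    = trans (P.coeff-0 (suc n)) (sym (Q.coeff-0 (suc n)))
      unique (suc n) (suc i) = apply-∂-injective isDelta (P.degree (suc n)) (Q.degree (suc n))
        (λ {j} _ → trans (P.lower-apply n (P.degree (suc n)) j)
          (trans (*-congˡ (unique n j)) (sym (Q.lower-apply n (Q.degree (suc n)) j))))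
        (s≤s z≤n)

    -- Connection polynomials

    module _ {φ₁ φ₂ φ₃ : Series} (isDelta₁ : IsDelta φ₁) (isDelta₂ : IsDelta φ₂)
             (φ₁≈φ₃∘φ₂ : φ₁ ≈ˢ (φ₃ ∘ˢ φ₂)) {p₁ p₂ : ℕ → Poly}
             (pp₁ : ArePoweroids φ₁ p₁) (pp₂ : ArePoweroids φ₂ p₂)
             {c : ℕ → ℕ → Carrier} (cc : AreConnectionConstants p₁ p₂ c) where

      open AreConnectionConstants cc
      private
        module P₁ = PoweroidProperties isDelta₁ pp₁
        module P₂ = PoweroidProperties isDelta₂ pp₂

      column : ℕ → Series
      column n m = c m n

      coeff-connectionPoly : ∀ n → coeff (connectionPoly n) ≈ˢ column n
      coeff-connectionPoly n m = trans
        (coeff-∑ₚ (range n) (λ k → c k n ·ₚ (X^ k)) m) (∑<-δʳ (range n) m (column n) finite)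

      T-column : ∀ {M} n → range n ≤ suc M → P₂.Expansion.T M (column n) ≈ˢ coeff (p₁ n)
      T-column n r≤N i = sym (trans (expansion n i) (trans (coeff-∑ₚ (range n) (λ k → c k n ·ₚ p₂ k) i)
        (∑<-extend r≤N λ r≤m → trans (*-congʳ (finite r≤m)) (zeroˡ _))))

      -- `T` sends both sides to the constant polynomial 1.
      column-initial : column 0 ≈ˢ δ 0
      column-initial = T-injective
        (λ N≤m → finite (ℕₚ.m+n≤o⇒n≤o 1 N≤m))
        (λ N≤m → vanishes (X^ 0) (ℕₚ.≤-trans (s≤s z≤n) N≤m))
        (λ i → trans (T-column 0 (ℕₚ.n≤1+n _) i) (trans (ArePoweroids.initial pp₁ i)
          (sym (trans (T-δ0 i) (ArePoweroids.initial pp₂ i)))))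
        where open P₂.Expansion (range 0)

      column-atZero : ∀ n → column (suc n) 0 ≈ 0#
      column-atZero n = trans (sym (T-0 (column (suc n))))
        (trans (T-column (suc n) (ℕₚ.n≤1+n _) 0) (P₁.coeff-0 (suc n)))
        where open P₂.Expansion (range (suc n))

      column-lower : ∀ n i → coeff ((φ₃ ⟨D⟩) (connectionPoly (suc n))) i ≈
                             (suc n ×ₙ 1#) * coeff (connectionPoly n) i
      column-lower n i = begin
        coeff ((φ₃ ⟨D⟩) (connectionPoly (suc n))) i
          ≈⟨ ⟨D⟩-apply φ₃ (connectionPoly (suc n))
               (λ N≤j → trans (coeff-connectionPoly (suc n) _) (below₊ N≤j)) i ⟩
        apply N φ₃ ∂ (coeff (connectionPoly (suc n))) i
          ≈⟨ cong (apply-linear N φ₃ ∂-linear) (coeff-connectionPoly (suc n)) i ⟩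
        apply N φ₃ ∂ (column (suc n)) i
          ≈⟨ T-injective (apply-∂-Below φ₃ below₊)
               (λ N≤j → trans (*-congˡ (below N≤j)) (zeroʳ _)) images i ⟩
        (suc n ×ₙ 1#) * column n i
          ≈⟨ *-congˡ (coeff-connectionPoly n i) ⟨
        (suc n ×ₙ 1#) * coeff (connectionPoly n) i
          ∎
        where
        -- One truncation has to accommodate both columns `n + 1` and `n`.
        open P₂.Expansion (range (suc n) ℕ.⊔ range n)
        r₊≤N : range (suc n) ≤ N
        r₊≤N = ℕₚ.m≤n⇒m≤1+n (ℕₚ.m≤m⊔n (range (suc n)) (range n))
        r≤N : range n ≤ N
        r≤N = ℕₚ.m≤n⇒m≤1+n (ℕₚ.m≤n⊔m (range (suc n)) (range n))
        below₊ : Below N (column (suc n))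
        below₊ N≤j = finite (ℕₚ.≤-trans r₊≤N N≤j)
        below : Below N (column n)
        below N≤j = finite (ℕₚ.≤-trans r≤N N≤j)
        -- The bound comes from `p₁ (suc n)` being an image under `T`, which matches the truncation
        -- `N` directly.
        p₁-Below : Below N (coeff (p₁ (suc n)))
        p₁-Below N≤j = trans (sym (T-column (suc n) r₊≤N _)) (T-Below (column (suc n)) N≤j)
        images : T (apply N φ₃ ∂ (column (suc n))) ≈ˢ T (λ m → (suc n ×ₙ 1#) * column n m)
        images j = begin
          T (apply N φ₃ ∂ (column (suc n))) j
            ≈⟨ apply-intertwines φ₃ below₊ j ⟨
          apply N φ₃ B (T (column (suc n))) j
            ≈⟨ cong (apply-linear N φ₃ B-linear) (T-column (suc n) r₊≤N) j ⟩
          apply N φ₃ B (coeff (p₁ (suc n))) j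
            -- Here `B` is φ₂(D), so φ₃(φ₂(D)) becomes the composite series in D, which is φ₁(D).
            ≈⟨ apply-∘ φ₃ {φ₂} (IsDelta.coeff₀ isDelta₂) ∂-linear (∂-nilpotent p₁-Below) j ⟨
          apply N (φ₃ ∘ˢ φ₂) ∂ (coeff (p₁ (suc n))) j
            ≈⟨ apply-cong N {φ₁} {φ₃ ∘ˢ φ₂} ∂ (coeff (p₁ (suc n))) φ₁≈φ₃∘φ₂ j ⟨
          apply N φ₁ ∂ (coeff (p₁ (suc n))) j
            ≈⟨ P₁.lower-apply n p₁-Below j ⟩
          (suc n ×ₙ 1#) * coeff (p₁ n) j
            ≈⟨ *-congˡ (T-column n r≤N j) ⟨
          (suc n ×ₙ 1#) * T (column n) j
            ≈⟨ ∑<-*ˡ N _ _ ⟩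
          ∑< N (λ m → (suc n ×ₙ 1#) * (column n m * coeff (p₂ m) j))
            ≈⟨ ∑<-cong N (λ m _ → *-assoc _ _ _) ⟨
          T (λ m → (suc n ×ₙ 1#) * column n m) j
            ∎

      connectionPoly-poweroids : ArePoweroids φ₃ connectionPoly
      connectionPoly-poweroids = record
        { initial = λ i → trans (coeff-connectionPoly 0 i) (column-initial i)
        ; lower   = column-lower
        ; atZero  = λ n → trans (eval-0 (connectionPoly (suc n)))
                      (trans (coeff-connectionPoly (suc n) 0) (column-atZero n))
        }

  -- Low coefficients of a composite series

  ∘ˢ-coeff₀ : ∀ f g → f 0 ≈ 0# → (f ∘ˢ g) 0 ≈ 0#
  ∘ˢ-coeff₀ f g f₀≈0 = trans (+-identityʳ _) (trans (*-congʳ f₀≈0) (zeroˡ _))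

  ∘ˢ-coeff₁ : ∀ f g → IsDelta f → g 0 ≈ 0# → (f ∘ˢ g) 1 ≈ g 1
  ∘ˢ-coeff₁ f g isDelta g₀≈0 = begin
    f 0 * 0# + (f 1 * (g 0 * 0# + (g 1 * 1# + 0#)) + 0#)
      ≈⟨ +-cong (zeroʳ _) (+-identityʳ _) ⟩
    0# + f 1 * (g 0 * 0# + (g 1 * 1# + 0#))
      ≈⟨ +-identityˡ _ ⟩
    f 1 * (g 0 * 0# + (g 1 * 1# + 0#))
      ≈⟨ *-cong (IsDelta.coeff₁ isDelta)
           (+-cong (zeroʳ _) (trans (+-identityʳ _) (*-identityʳ _))) ⟩
    1# * (0# + g 1)
      ≈⟨ trans (*-identityˡ _) (+-identityˡ _) ⟩
    g 1
      ∎

mainTheorem7 :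
    ∀ {a ℓ₁ ℓ₂} (F : HeytingField a ℓ₁ ℓ₂) →
    let open HeytingField F
        open Poweroids F
    in
    CharacteristicZero →
    (φ₁ φ₂ : Series) → IsDelta φ₁ → IsDelta φ₂ →
    (p₁ p₂ : ℕ → Poly) → ArePoweroids φ₁ p₁ → ArePoweroids φ₂ p₂ →
    (c : ℕ → ℕ → Carrier) (cc : AreConnectionConstants p₁ p₂ c) →
    (φ₂⁻¹ : Series) → IsCompositionalInverse φ₂ φ₂⁻¹ →
    let φ₃ = φ₁ ∘ˢ φ₂⁻¹ in
      IsDelta φ₃
    × φ₁ ≈ˢ (φ₃ ∘ˢ φ₂)
    × ArePoweroids φ₃ (AreConnectionConstants.connectionPoly cc)
    × ((p₃ : ℕ → Poly) → ArePoweroids φ₃ p₃ →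
         ∀ m n → c m n ≈ coeff (p₃ n) m)
mainTheorem7 F char0 φ₁ φ₂ isDelta₁ isDelta₂ p₁ p₂ pp₁ pp₂ c cc ψ inverse =
    isDelta₃ , φ₁≈φ₃∘φ₂ , pp₃
  , λ p₃ pp m n → trans (sym (coeff-connectionPoly F char0 {φ₁} {φ₂} {φ₃} isDelta₁ isDelta₂ φ₁≈φ₃∘φ₂ pp₁ pp₂ cc n m))
                    (poweroids-unique F char0 {φ₃} isDelta₃ pp₃ pp n m)
  where
  open HeytingField F using (sym; trans)
  open Poweroids F
  open IsCompositionalInverse inverse
  φ₃ = φ₁ ∘ˢ ψ
  φ₁≈φ₃∘φ₂ : φ₁ ≈ˢ (φ₃ ∘ˢ φ₂)
  φ₁≈φ₃∘φ₂ n = sym (∘ˢ-cancelʳ F {φ₂} {ψ} (IsDelta.coeff₀ isDelta₂) zeroConstant inverseˡ φ₁ n)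
  isDelta₃ : IsDelta φ₃
  isDelta₃ = record
    { coeff₀ = ∘ˢ-coeff₀ F φ₁ ψ (IsDelta.coeff₀ isDelta₁)
    -- The linear coefficient of φ₃ is that of `ψ`, and so is the linear coefficient of φ₂ ∘ ψ = t,
    -- which is 1.
    ; coeff₁ = trans (∘ˢ-coeff₁ F φ₁ ψ isDelta₁ zeroConstant)
                 (trans (sym (∘ˢ-coeff₁ F φ₂ ψ isDelta₂ zeroConstant)) (inverseʳ 1))
    }
  pp₃ = connectionPoly-poweroids F char0 {φ₁} {φ₂} {φ₃} isDelta₁ isDelta₂ φ₁≈φ₃∘φ₂ pp₁ pp₂ cc
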